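{- Let $T$ be a nonspecial tree of height $\omega_1$. Then $\diamondsuit_T$ implies $2^\omega\le|T_{\ge\omega}|$, where $T_{\geq\omega}$ is the set of nodes of $T$ of height at least $\omega$.
   Context: A tree is a partial order $(T,<_T)$ in which the set of predecessors of each node is well-ordered; every tree is assumed to have a root, denoted $\emptyset$. For $t\in T$, $t{\downarrow}=\{s\in T\mid s<_T t\}$, $\mathrm{ht}(t)$ is the order type of $t{\downarrow}$, and $T_\alpha$ is the set of nodes of height $\alpha$. The height of $T$ is the least $\alpha$ with $T_\alpha=\emptyset$. Levels are not assumed to be countable. An antichain is a set of pairwise incomparable nodes. A set $U\subseteq T$ is special if it is a union of at most countably many antichains; otherwise it is nonspecial. For $X\subseteq T$, a map $f:X\to T$ is regressive if $f(t)<_T t$ for all $t\in X\setminus\{\emptyset\}$. For $T$ of height $\omega_1$, $NS^T$ is the ideal of all $B\subseteq T$ for which there is a regressive $f:B\to T$ such that $f^{ -1}(\{t\})$ is special for every $t\in T$. For a nonspecial tree $T$ of height $\omega_1$, $\diamondsuit_T$ asserts that there is a sequence $(D_t\mid t\in T)$ with $D_t\subseteq t{\downarrow}$ for all $t\in T$ such that for every $X\subseteq T$, $\{t\in T\mid X\cap t{\downarrow}=D_t\}\notin NS^T$. -}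

module Defs where

open import Data.Nat using (ℕ)
import Data.Nat as ℕ
import Data.Nat.Induction as ℕ
import Data.Nat.Properties as ℕ
open import Data.Product using (Σ; ∃; _×_; _,_; proj₁)
open import Data.Sum using (_⊎_)
open import Function.Base using (_on_)
open import Function.Bundles using (Func; Injection)
open import Induction.WellFounded using (WellFounded)
open import Level using (Level; 0ℓ; suc; _⊔_)
open import Relation.Binary.Bundles using (Setoid)
open import Relation.Binary.Core using (Rel)
import Relation.Binary.Construct.On as On
open import Relation.Binary.Morphism.Structures using (IsOrderIsomorphism)
open import Relation.Binary.PropositionalEquality using (_≡_; _≢_; setoid)
open import Relation.Binary.Structures using (IsStrictPartialOrder; IsStrictTotalOrder)
open import Relation.Nullary using (¬_)
open import Relation.Unary using (Pred; _∈_; _⊆_; _≐_; _∩_; Empty; U; ⋃)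

private
  variable
    a b c a′ b′ c′ ℓ p : Level

-- A subset of A is a predicate P, and an element of it is a pair (x , x∈P).
-- Two such pairs count as equal when their first components are, so that
-- different proofs of x∈P do not give different elements.
⟦_⟧ : {A : Set a} → Pred A p → Setoid (a ⊔ p) a
⟦_⟧ {A = A} P = On.setoid {B = ∃ P} (setoid A) proj₁

------------------------------------------------------------------------
-- Ordinals are represented by well-orders, compared up to isomorphism.
-- Well-foundedness is accessibility of every element; given excluded middle
-- this says that every nonempty subset has a least element.

record IsWellOrder {A : Set a} (_≈_ : Rel A b) (_<_ : Rel A c) : Set (a ⊔ b ⊔ c) where
  field
    isStrictTotalOrder : IsStrictTotalOrder _≈_ _<_
    wellFounded        : WellFounded _<_

record Ordinal a b c : Set (suc (a ⊔ b ⊔ c)) where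
  field
    Carrier     : Set a
    _≈_         : Rel Carrier b
    _<_         : Rel Carrier c
    isWellOrder : IsWellOrder _≈_ _<_

  open IsWellOrder isWellOrder public

  underlying : Setoid a b
  underlying = record
    { isEquivalence = IsStrictTotalOrder.isEquivalence isStrictTotalOrder }

infix 4 _≅_ _≺_ _≼_

_≅_ : Ordinal a b c → Ordinal a′ b′ c′ → Set (a ⊔ b ⊔ c ⊔ a′ ⊔ b′ ⊔ c′)
α ≅ β = ∃ λ (f : α.Carrier → β.Carrier) →
          IsOrderIsomorphism α._≈_ β._≈_ α._<_ β._<_ f
  where
  module α = Ordinal α
  module β = Ordinal β

segment : (α : Ordinal a b c) → Ordinal.Carrier α → Ordinal (a ⊔ c) b c
segment α x = record
  { Carrier     = ∃ λ y → y < x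
  ; _≈_         = _≈_ on proj₁
  ; _<_         = _<_ on proj₁
  ; isWellOrder = record
    { isStrictTotalOrder = On.isStrictTotalOrder proj₁ isStrictTotalOrder
    ; wellFounded        = On.wellFounded proj₁ wellFounded
    }
  }
  where open Ordinal α

_≺_ : Ordinal a b c → Ordinal a′ b′ c′ → Set (a ⊔ b ⊔ c ⊔ a′ ⊔ b′ ⊔ c′)
α ≺ β = ∃ λ x → α ≅ segment β x

_≼_ : Ordinal a b c → Ordinal a′ b′ c′ → Set (a ⊔ b ⊔ c ⊔ a′ ⊔ b′ ⊔ c′)
α ≼ β = α ≺ β ⊎ α ≅ β

ω : Ordinal 0ℓ 0ℓ 0ℓ
ω = record
  { Carrier     = ℕ
  ; _≈_         = _≡_
  ; _<_         = ℕ._<_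
  ; isWellOrder = record
    { isStrictTotalOrder = ℕ.<-isStrictTotalOrder
    ; wellFounded        = ℕ.<-wellFounded
    }
  }

Countable : Ordinal a b c → Set (a ⊔ b)
Countable α = Injection (Ordinal.underlying α) (setoid ℕ)

-- ω₁ is characterised as the least uncountable ordinal.
Isω₁ : Ordinal a b c → Set (suc (a ⊔ b ⊔ c))
Isω₁ {a} {b} {c} α =
  ¬ Countable α × ((β : Ordinal a b c) → β ≺ α → Countable β)

------------------------------------------------------------------------
-- Trees

record Tree ℓ : Set (suc ℓ) where
  infix 4 _<_
  field
    Node                 : Set ℓ
    _<_                  : Rel Node ℓ
    isStrictPartialOrder : IsStrictPartialOrder _≡_ _<_
    ∅                    : Node
    ∅-least              : ∀ t → t ≢ ∅ → ∅ < t

  _↓ : Node → Pred Node ℓ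
  t ↓ = λ s → s < t

  field
    ↓-isWellOrder : ∀ t → IsWellOrder {A = ∃ (t ↓)} (_≡_ on proj₁) (_<_ on proj₁)

module _ (T : Tree ℓ) where
  open Tree T

  ht : Node → Ordinal ℓ ℓ ℓ
  ht t = record { isWellOrder = ↓-isWellOrder t }

  LevelAt : Ordinal ℓ ℓ ℓ → Pred Node ℓ
  LevelAt α t = ht t ≅ α

  HasHeight : Ordinal ℓ ℓ ℓ → Set (suc ℓ)
  HasHeight α = Empty (LevelAt α) × (∀ β → β ≺ α → ¬ Empty (LevelAt β))

  HasHeightω₁ : Set (suc ℓ)
  HasHeightω₁ = ∃ λ α → Isω₁ α × HasHeight α

  AtLeastω : Pred Node ℓ
  AtLeastω t = ω ≼ ht t

  Antichain : Pred Node p → Set (ℓ ⊔ p)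
  Antichain A = ∀ {s t} → s ∈ A → t ∈ A → s ≢ t → ¬ (s < t ⊎ t < s)

  -- Finite unions are covered, since the empty set is an antichain.
  Special : Pred Node p → Set (suc ℓ ⊔ p)
  Special X = ∃ λ (A : ℕ → Pred Node ℓ) →
    (∀ n → Antichain (A n)) × X ≐ ⋃ ℕ A

  Nonspecial : Set (suc ℓ)
  Nonspecial = ¬ Special U

  Map : Pred Node ℓ → Set ℓ
  Map X = Func ⟦ X ⟧ (setoid Node)

  Regressive : {X : Pred Node ℓ} → Map X → Set ℓ
  Regressive f = ∀ x → proj₁ x ≢ ∅ → Func.to f x < proj₁ x

  Fibre : {X : Pred Node ℓ} → Map X → Node → Pred Node ℓ
  Fibre {X} f t s = Σ (s ∈ X) λ s∈X → Func.to f (s , s∈X) ≡ t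

  NS : Pred Node ℓ → Set (suc ℓ)
  NS B = ∃ λ (f : Map B) → Regressive f × (∀ t → Special (Fibre f t))

  ◇ : Set (suc ℓ)
  ◇ = ∃ λ (D : Node → Pred Node ℓ) →
    (∀ t → D t ⊆ t ↓) ×
    ((X : Pred Node ℓ) → ¬ NS (λ t → (X ∩ t ↓) ≐ D t))

{-# OPTIONS --safe #-}
-- For r : ℕ → Bool let X_r be the union of the levels Tₙ with r n = true.  The
-- nodes of finite height form a countable union of antichains, so they lie in
-- NS (take the constant regressive map ∅).  Hence the set of t with
-- X_r ∩ t↓ = D_t contains some t_r of infinite height.  The predecessors of
-- t_r meet every finite level, so D_{t_r} determines r.
module Submission where

open import Defs
open import Axiom.DoubleNegationElimination using (em⇒dne)
open import Axiom.ExcludedMiddle using (ExcludedMiddle)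
open import Axiom.Extensionality.Propositional using (Extensionality)
open import Data.Bool using (Bool; true)
open import Data.Bool.Properties using (⇔→≡)
open import Data.Nat using (ℕ; zero; suc)
import Data.Nat as ℕ
import Data.Nat.Properties as ℕ
open import Data.Product using (∃; _×_; _,_; proj₁; proj₂)
open import Data.Sum using (_⊎_; inj₁; inj₂)
open import Function.Bundles using (Injection; mk⇔)
open import Function.Definitions using (StrictlySurjective)
open import Induction.WellFounded using (WellFounded; Acc; acc)
open import Level using (Level; 0ℓ)
open import Relation.Binary.Core using (Rel)
open import Relation.Binary.Definitions using (tri<; tri≈; tri>)
open import Relation.Binary.PropositionalEquality
  using (_≡_; refl; sym; cong; subst; _→-setoid_)
open import Relation.Binary.Structures using (IsStrictPartialOrder; IsStrictTotalOrder)
open import Relation.Nullary using (¬_; yes; no; contradiction)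
open import Relation.Unary using (Pred; _≐_; _∩_)

private
  variable
    a b c ℓ : Level

∃-minimal : {A : Set ℓ} {_<_ : Rel A ℓ} → ExcludedMiddle ℓ → WellFounded _<_ →
            (P : Pred A ℓ) → ∃ P → ∃ λ x → P x × (∀ y → y < x → ¬ P y)
∃-minimal {A = A} {_<_} em wf P (x₀ , px₀) = go px₀ (wf x₀)
  where
  go : ∀ {x} → P x → Acc _<_ x → ∃ λ x → P x × (∀ y → y < x → ¬ P y)
  go {x} px (acc rs) with em {∃ λ y → y < x × P y}
  ... | yes (y , y<x , py) = go py (rs y<x)
  ... | no ¬y              = x , px , λ y y<x py → ¬y (y , y<x , py)

module _ (β : Ordinal a b c) where
  open Ordinal β
  private module < = IsStrictTotalOrder isStrictTotalOrder

  -- Consecutive steps give monotonicity, and trichotomy on `ℕ` then yields injectivity and order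
  -- reflection. This serves both `ht T t` and a proper segment of it.
  increasing-enumeration⇒ω≅ : (f : ℕ → Carrier) → (∀ n → f n < f (suc n)) →
                              StrictlySurjective _≈_ f → ω ≅ β
  increasing-enumeration⇒ω≅ f step surj = f , record
    { isOrderMonomorphism = record
      { isOrderHomomorphism = record { cong = ≡⇒≈ ; mono = mono }
      ; injective           = injective
      ; cancel              = cancel
      }
    ; surjective = λ y → proj₁ (surj y) , λ { refl → proj₂ (surj y) }
    }
    where
    ≡⇒≈ : ∀ {m n} → m ≡ n → f m ≈ f n
    ≡⇒≈ refl = <.Eq.refl

    mono : ∀ {m n} → m ℕ.< n → f m < f n
    mono {n = suc n} (ℕ.s≤s m≤n) with ℕ.m≤n⇒m<n∨m≡n m≤n
    ... | inj₁ m<n  = <.trans (mono m<n) (step n)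
    ... | inj₂ refl = step n

    injective : ∀ {m n} → f m ≈ f n → m ≡ n
    injective {m} {n} fm≈fn with ℕ.<-cmp m n
    ... | tri< m<n _ _ = contradiction (mono m<n) (<.irrefl fm≈fn)
    ... | tri≈ _ m≡n _ = m≡n
    ... | tri> _ _ n<m = contradiction (mono n<m) (<.irrefl (<.Eq.sym fm≈fn))

    cancel : ∀ {m n} → f m < f n → m ℕ.< n
    cancel {m} {n} fm<fn with ℕ.<-cmp m n
    ... | tri< m<n _ _  = m<n
    ... | tri≈ _ refl _ = contradiction fm<fn (<.irrefl <.Eq.refl)
    ... | tri> _ _ n<m  = contradiction (mono n<m) (<.asym fm<fn)

module _ (T : Tree ℓ) where
  open Tree T
  private module < = IsStrictPartialOrder isStrictPartialOrder

  infix 4 _⋖_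

  -- The immediate-predecessor relation: `s` is the greatest element of `t ↓`.
  _⋖_ : Rel Node ℓ
  s ⋖ t = s < t × (∀ u → u < t → u < s ⊎ u ≡ s)

  -- Recursion along `_⋖_` instead of an isomorphism with `ht T t` makes the finite levels
  -- accessible to induction on `n`.
  Level[_] : ℕ → Pred Node ℓ
  Level[ zero  ] t = t ≡ ∅
  Level[ suc n ] t = ∃ λ s → s ⋖ t × Level[ n ] s

  InfiniteHeight : Pred Node ℓ
  InfiniteHeight t = ∀ n → ¬ Level[ n ] t

  ≮∅ : ∀ {s} → ¬ s < ∅
  ≮∅ {s} s<∅ = <.irrefl refl (<.trans s<∅ (∅-least s λ { refl → <.irrefl refl s<∅ }))

  ⋖-unique : ∀ {s s′ t} → s ⋖ t → s′ ⋖ t → s ≡ s′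
  ⋖-unique {s} {s′} (s<t , below-s) (s′<t , below-s′) with below-s s′ s′<t | below-s′ s s<t
  ... | inj₂ s′≡s | _         = sym s′≡s
  ... | inj₁ _    | inj₂ s≡s′ = s≡s′
  ... | inj₁ s′<s | inj₁ s<s′ = contradiction s<s′ (<.asym s′<s)

  Level-unique : ∀ m n {t} → Level[ m ] t → Level[ n ] t → m ≡ n
  Level-unique zero    zero    _    _    = refl
  Level-unique zero    (suc n) refl (_ , (s<∅ , _) , _) = contradiction s<∅ ≮∅
  Level-unique (suc m) zero    (_ , (s<∅ , _) , _) refl = contradiction s<∅ ≮∅
  Level-unique (suc m) (suc n) (_ , s⋖t , s∈m) (_ , s′⋖t , s′∈n)
    with refl ← ⋖-unique s⋖t s′⋖t = cong suc (Level-unique m n s∈m s′∈n)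

  -- If `s < t`, then `s` is at or below the immediate predecessor of `t`, so the immediate
  -- predecessors of `s` and `t` are comparable one level down.
  Level-incomparable : ∀ n {s t} → Level[ n ] s → Level[ n ] t → ¬ s < t
  Level-incomparable zero refl refl ∅<∅ = ≮∅ ∅<∅
  Level-incomparable (suc n) {s} (s′ , (s′<s , _) , s′∈n) (t′ , (_ , below-t′) , t′∈n) s<t
    with below-t′ s s<t
  ... | inj₁ s<t′ = Level-incomparable n s′∈n t′∈n (<.trans s′<s s<t′)
  ... | inj₂ refl = Level-incomparable n s′∈n t′∈n s′<s

  special∈NS : {B : Pred Node ℓ} → Special T B → NS T B
  special∈NS {B} (A , antichain , B⊆⋃A , ⋃A⊆B) =
    record { to = λ _ → ∅ ; cong = λ _ → refl } ,
    (λ x → ∅-least (proj₁ x)) ,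
    -- The fibre over the root is all of `B` and every other fibre is empty; the conjunct `∅ ≡ t`
    -- treats both cases at once.
    λ t → (λ n s → A n s × ∅ ≡ t) ,
          (λ n (s∈A , _) (t∈A , _) → antichain n s∈A t∈A) ,
          (λ (s∈B , ∅≡t) → proj₁ (B⊆⋃A s∈B) , proj₂ (B⊆⋃A s∈B) , ∅≡t) ,
          (λ (n , s∈A , ∅≡t) → ⋃A⊆B (n , s∈A) , ∅≡t)

  finite-heights-special : {B : Pred Node ℓ} →
                           (∀ {t} → B t → ∃ λ n → Level[ n ] t) → Special T B
  finite-heights-special {B} level =
    (λ n t → B t × Level[ n ] t) ,
    (λ { n (_ , s∈n) (_ , t∈n) _ (inj₁ s<t) → Level-incomparable n s∈n t∈n s<t
       ; n (_ , s∈n) (_ , t∈n) _ (inj₂ t<s) → Level-incomparable n t∈n s∈n t<s }) ,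
    (λ t∈B → proj₁ (level t∈B) , t∈B , proj₂ (level t∈B)) ,
    (λ (_ , t∈B , _) → t∈B)

  ∃InfiniteHeight : ExcludedMiddle ℓ → {B : Pred Node ℓ} → ¬ NS T B →
                    ∃ λ t → B t × InfiniteHeight t
  ∃InfiniteHeight em B∉NS = em⇒dne em λ ¬∃ → B∉NS (special∈NS (finite-heights-special
    λ {t} t∈B → em⇒dne em λ ¬level → ¬∃ (t , t∈B , λ n t∈n → ¬level (n , t∈n))))

  module _ (em : ExcludedMiddle ℓ) {t : Node} (t-inf : InfiniteHeight t) where
    private
      module ↓ = IsWellOrder (↓-isWellOrder t)
      module ↓< = IsStrictTotalOrder ↓.isStrictTotalOrder

    -- Otherwise `s` would be the greatest predecessor of `t`, putting `t` on level `suc n`.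
    ∃-between : ∀ {n s} → s < t → Level[ n ] s → ∃ λ (w : ∃ (t ↓)) → s < proj₁ w
    ∃-between {n} {s} s<t s∈n = em⇒dne em λ ¬between →
      t-inf (suc n) (s , (s<t , below ¬between) , s∈n)
      where
      below : ¬ ∃ (λ (w : ∃ (t ↓)) → s < proj₁ w) → ∀ u → u < t → u < s ⊎ u ≡ s
      below ¬between u u<t with ↓<.compare (u , u<t) (s , s<t)
      ... | tri< u<s _ _ = inj₁ u<s
      ... | tri≈ _ u≡s _ = inj₂ u≡s
      ... | tri> _ _ s<u = contradiction ((u , u<t) , s<u) ¬between

    -- Take the least node of `t ↓` above `s`: by minimality nothing lies strictly between the two,
    -- and `t ↓` is linearly ordered.
    ∃-⋖-below : ∀ {n s} → s < t → Level[ n ] s → ∃ λ w → w < t × s ⋖ w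
    ∃-⋖-below {n} {s} s<t s∈n
      with (w , w<t) , s<w , min ←
           ∃-minimal em ↓.wellFounded (λ w → s < proj₁ w) (∃-between s<t s∈n)
      = w , w<t , s<w , below
      where
      below : ∀ u → u < w → u < s ⊎ u ≡ s
      below u u<w with ↓<.compare (u , <.trans u<w w<t) (s , s<t)
      ... | tri< u<s _ _ = inj₁ u<s
      ... | tri≈ _ u≡s _ = inj₂ u≡s
      ... | tri> _ _ s<u = contradiction s<u (min (u , <.trans u<w w<t) u<w)

    branch : ∀ n → ∃ λ s → s < t × Level[ n ] s
    branch zero = ∅ , ∅-least t (t-inf zero) , refl
    branch (suc n) with s , s<t , s∈n ← branch n
                   with w , w<t , s⋖w ← ∃-⋖-below s<t s∈n = w , w<t , s , s⋖w , s∈n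

    node : ℕ → Node
    node n = proj₁ (branch n)

    node<t : ∀ n → node n < t
    node<t n = proj₁ (proj₂ (branch n))

    node-level : ∀ n → Level[ n ] (node n)
    node-level n = proj₂ (proj₂ (branch n))

    -- True by construction: matching on `branch n` lets `node (suc n)` reduce to the successor
    -- supplied by `∃-⋖-below`.
    node-⋖ : ∀ n → node n ⋖ node (suc n)
    node-⋖ n with s , s<t , s∈n ← branch n = proj₂ (proj₂ (∃-⋖-below s<t s∈n))

    node-step : ∀ n → node n < node (suc n)
    node-step n = proj₁ (node-⋖ n)

    -- The branch is downward closed, so a node that it misses cannot lie below any of its members.
    <node⇒node : ∀ n {w} → w < node n → ∃ λ k → node k ≡ w
    <node⇒node zero    w<∅ = contradiction w<∅ ≮∅
    <node⇒node (suc n) w<node with proj₂ (node-⋖ n) _ w<node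
    ... | inj₁ w<node′ = <node⇒node n w<node′
    ... | inj₂ w≡node  = n , sym w≡node

    -- Either the branch exhausts `t ↓`, which is then a copy of `ω`, or there is a least missed
    -- node `v`. Below `v` everything is on the branch by minimality, and the whole branch lies
    -- below `v` by downward closure, so the segment at `v` is a copy of `ω`.
    InfiniteHeight⇒AtLeastω : AtLeastω T t
    InfiniteHeight⇒AtLeastω with em {∃ λ (v : ∃ (t ↓)) → ¬ ∃ λ n → node n ≡ proj₁ v}
    ... | no ¬missed = inj₂ (increasing-enumeration⇒ω≅ (ht T t)
            (λ n → node n , node<t n) node-step
            (λ v → em⇒dne em λ v-missed → ¬missed (v , v-missed)))
    ... | yes missed
      with v , v-missed , min ← ∃-minimal em ↓.wellFounded _ missed
      = inj₁ (v , increasing-enumeration⇒ω≅ (segment (ht T t) v)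
            (λ n → (node n , node<t n) , node<v n) node-step
            (λ (w , w<v) → em⇒dne em (min w w<v)))
      where
      node<v : ∀ n → node n < proj₁ v
      node<v n with ↓<.compare (node n , node<t n) v
      ... | tri< node<v _ _ = node<v
      ... | tri≈ _ node≡v _ = contradiction (n , node≡v) v-missed
      ... | tri> _ _ v<node = contradiction (<node⇒node n v<node) v-missed

  LevelsIn : (ℕ → Bool) → Pred Node ℓ
  LevelsIn r s = ∃ λ n → r n ≡ true × Level[ n ] s

  -- The predecessor of `t` on level `n` passes through `D` into `LevelsIn r′`, and a node has only
  -- one level, so the index found there is `n` itself.
  trace-reflects-⊆ : ExcludedMiddle ℓ → ∀ {D : Pred Node ℓ} {t r r′} → InfiniteHeight t →
                     (LevelsIn r ∩ t ↓) ≐ D → (LevelsIn r′ ∩ t ↓) ≐ D →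
                     ∀ n → r n ≡ true → r′ n ≡ true
  trace-reflects-⊆ em {r′ = r′} t-inf (X⊆D , _) (_ , D⊆X′) n rn
    with s , s<t , s∈n ← branch em t-inf n
    with (m , r′m , s∈m) , _ ← D⊆X′ (X⊆D ((n , rn , s∈n) , s<t))
    = subst (λ k → r′ k ≡ true) (Level-unique m n s∈m s∈n) r′m

proposition3p22 : ∀ {ℓ} → ExcludedMiddle ℓ → Extensionality 0ℓ 0ℓ →
    (T : Tree ℓ) → HasHeightω₁ T → Nonspecial T → ◇ T →
    Injection (ℕ →-setoid Bool) ⟦ AtLeastω T ⟧
proposition3p22 em ext T _ _ (D , _ , guess) = record
  { to        = λ r → node-of r , InfiniteHeight⇒AtLeastω T em (infinite r)
  -- The chosen node depends on `r` as a function, so pointwise equality must first become equality.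
  ; cong      = λ r≗r′ → cong node-of (ext r≗r′)
  ; injective = λ {r} {r′} eq n → ⇔→≡ (mk⇔
      (trace-reflects-⊆ T em (infinite r) (guessed r) (guessed-at eq) n)
      (trace-reflects-⊆ T em (infinite r) (guessed-at eq) (guessed r) n))
  }
  where
  open Tree T

  choice : ∀ r → ∃ λ t → ((LevelsIn T r ∩ t ↓) ≐ D t) × InfiniteHeight T t
  choice r = ∃InfiniteHeight T em (guess (LevelsIn T r))

  node-of : (ℕ → Bool) → Node
  node-of r = proj₁ (choice r)

  guessed : ∀ r → (LevelsIn T r ∩ node-of r ↓) ≐ D (node-of r)
  guessed r = proj₁ (proj₂ (choice r))

  infinite : ∀ r → InfiniteHeight T (node-of r)
  infinite r = proj₂ (proj₂ (choice r))

  -- Transports the guess for `r′` to the node chosen for `r`, so that both traces equal one and the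
  -- same set.
  guessed-at : ∀ {r r′} → node-of r ≡ node-of r′ →
               (LevelsIn T r′ ∩ node-of r ↓) ≐ D (node-of r)
  guessed-at {r′ = r′} eq =
    subst (λ t → (LevelsIn T r′ ∩ t ↓) ≐ D t) (sym eq) (guessed r′)
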